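{- There exists a set $\mathcal{A}$ of positive integers which is a Sidon set and is an asymptotic basis of order $4$.
   Context: A set $\mathcal{A}$ of positive integers is a Sidon set if all sums $a+b$ with $a,b\in\mathcal{A}$, $a\le b$, are distinct. For an integer $h\ge 2$, $\mathcal{A}$ is an asymptotic basis of order $h$ if there is $n_0$ such that every integer $n>n_0$ can be written as $n=a_1+\dots+a_h$ with $a_1,\dots,a_h\in\mathcal{A}$ (repetitions allowed). -}

module Defs where

open import Data.Nat using (ℕ; _+_; _≤_; _<_)
open import Data.Product using (Σ; ∃; _×_; _,_)
open import Relation.Binary.PropositionalEquality using (_≡_)

SetOfℕ : Set₁
SetOfℕ = ℕ → Set

Positive : SetOfℕ → Set
Positive A = ∀ a → A a → 0 < a

Sidon : SetOfℕ → Set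
Sidon A = ∀ a b c d → A a → A b → A c → A d → a ≤ b → c ≤ d →
          a + b ≡ c + d → (a ≡ c) × (b ≡ d)

AsymptoticBasis4 : SetOfℕ → Set
AsymptoticBasis4 A = ∃ λ n₀ → ∀ n → n₀ < n →
  ∃ λ a₁ → ∃ λ a₂ → ∃ λ a₃ → ∃ λ a₄ →
    A a₁ × A a₂ × A a₃ × A a₄ × (n ≡ a₁ + a₂ + a₃ + a₄)

{-# OPTIONS --safe #-}

-- The set is built greedily, by a first-moment argument.  Put s = 2^ℓ and
-- k ~ s⁴, let B be a finite Sidon set with |B|³ much smaller than k, and let
-- U be the set of points of the window [4k, 64k] that are not yet sums of
-- four elements.  Draw four groups of s integers uniformly at random from
-- [1, 64k] and discard every drawn x that satisfies a non-trivial equation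
-- x + α = β + γ with α, β, γ drawn or in B; adding the survivors keeps the
-- set Sidon.  For a fixed u the expected number of ways to write u as a sum
-- of one draw from each group is of order s⁴/k.  The expected number of
-- those ways that use a discarded element is O(s⁴ (|B| + 4s)³/k²), and the
-- expected number of coincidences between two of them is O(s⁸/k²), because
-- two independent linear equations determine two of the draws.  Hence u
-- becomes a sum of four survivors with probability at least a constant 1/D,
-- and some draw reduces |U| by the factor 1 − 1/D.  So O(log k) rounds
-- exhaust the window, B grows only by O(s log k), and the construction
-- passes on to the next ℓ.
module Submission where

open import Defs
open import Data.Fin using (Fin; zero; suc; combine; punchIn)
open import Data.Fin.Patterns using (0F; 1F; 2F; 3F)
import Data.Fin.Properties as Fin
open import Data.List using (List; []; _∷_; _++_; length; map; upTo; applyUpTo; allFin;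
  cartesianProductWith; filter)
open import Data.List.Membership.Propositional using (_∈_; find; lose)
open import Data.List.Membership.Propositional.Properties
open import Data.List.Properties using (length-upTo; length-++; length-map; length-filter; length-tabulate)
open import Data.List.Relation.Unary.All as All using ([])
open import Data.List.Relation.Unary.AllPairs using ([]; _∷_)
open import Data.List.Relation.Unary.Any using (Any; any?; here; there)
open import Data.List.Relation.Unary.Unique.Propositional using (Unique)
import Data.List.Relation.Unary.Unique.Propositional.Properties as Unique
open import Data.Nat using (ℕ; zero; suc; _+_; _*_; _∸_; _^_; _≤_; _<_; _≤′_;
  ≤′-reflexive; ≤′-step; z≤n; s≤s; _≟_; _<?_; >-nonZero)
open import Data.Nat.Properties hiding (_≟_)
open import Data.Nat.Tactic.RingSolver using (solve-∀)
open import Data.Product using (Σ; ∃; _×_; _,_; proj₁; proj₂)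
open import Data.Sum using (_⊎_; inj₁; inj₂)
import Data.Sum as Sum
import Data.Sum.Properties as Sum
open import Data.Vec using (Vec; []; _∷_; lookup; _[_]≔_)
open import Data.Vec.Properties using (∷-injective; lookup∘update; lookup∘update′; ≡-dec)
open import Function using (_∘_; id)
open import Relation.Binary.Definitions using (DecidableEquality)
open import Relation.Binary.PropositionalEquality
open import Relation.Nullary using (Dec; yes; no; ¬_; contradiction)
open import Relation.Nullary.Decidable using (_×-dec_; ¬?; decidable-stable)
open import Relation.Unary using (Decidable)

-- Sums over lists

private variable
  I H L : Set

∑ : List I → (I → ℕ) → ℕ
∑ []       f = 0
∑ (x ∷ xs) f = f x + ∑ xs f

syntax ∑ xs (λ x → e) = ∑[ x ∈ xs ] e

𝟙 : Dec I → ℕ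
𝟙 (yes _) = 1
𝟙 (no  _) = 0

𝟙≤1 : (d : Dec I) → 𝟙 d ≤ 1
𝟙≤1 (yes _) = ≤-refl
𝟙≤1 (no  _) = z≤n

𝟙-yes : (d : Dec I) → I → 1 ≤ 𝟙 d
𝟙-yes (yes _) _ = ≤-refl
𝟙-yes (no ¬a) a = contradiction a ¬a

𝟙-pos : (d : Dec I) → 0 < 𝟙 d → I
𝟙-pos (yes a) _ = a

∑-mono : ∀ (xs : List I) {f g} → (∀ {x} → x ∈ xs → f x ≤ g x) → ∑ xs f ≤ ∑ xs g
∑-mono []       f≤g = z≤n
∑-mono (x ∷ xs) f≤g = +-mono-≤ (f≤g (here refl)) (∑-mono xs (f≤g ∘ there))

∑-mono-< : ∀ (xs : List I) {f g y} → (∀ {x} → x ∈ xs → f x ≤ g x) →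
           y ∈ xs → f y < g y → ∑ xs f < ∑ xs g
∑-mono-< (x ∷ xs) f≤g (here refl) fy<gy = +-mono-<-≤ fy<gy (∑-mono xs (f≤g ∘ there))
∑-mono-< (x ∷ xs) f≤g (there y∈)  fy<gy =
  +-mono-≤-< (f≤g (here refl)) (∑-mono-< xs (f≤g ∘ there) y∈ fy<gy)

∑-cong : ∀ (xs : List I) {f g} → (∀ x → f x ≡ g x) → ∑ xs f ≡ ∑ xs g
∑-cong []       f≗g = refl
∑-cong (x ∷ xs) f≗g = cong₂ _+_ (f≗g x) (∑-cong xs f≗g)

∑-const : ∀ (xs : List I) c → ∑[ _ ∈ xs ] c ≡ length xs * c
∑-const []       c = refl
∑-const (x ∷ xs) c = cong (c +_) (∑-const xs c)

∑-+ : ∀ (xs : List I) f g → ∑[ x ∈ xs ] (f x + g x) ≡ ∑ xs f + ∑ xs g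
∑-+ []       f g = refl
∑-+ (x ∷ xs) f g rewrite ∑-+ xs f g = lemma (f x) (g x) (∑ xs f) (∑ xs g)
  where
  lemma : ∀ a b c d → a + b + (c + d) ≡ a + c + (b + d)
  lemma = solve-∀

*-∑ : ∀ k (xs : List I) f → k * ∑ xs f ≡ ∑[ x ∈ xs ] (k * f x)
*-∑ k []       f = *-zeroʳ k
*-∑ k (x ∷ xs) f = trans (*-distribˡ-+ k (f x) (∑ xs f)) (cong (k * f x +_) (*-∑ k xs f))

∑-swap : ∀ (xs : List I) (ys : List H) (f : I → H → ℕ) →
         ∑[ x ∈ xs ] ∑ ys (f x) ≡ ∑[ y ∈ ys ] ∑[ x ∈ xs ] f x y
∑-swap []       ys f = sym (trans (∑-const ys 0) (*-zeroʳ (length ys)))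
∑-swap (x ∷ xs) ys f = trans (cong (∑ ys (f x) +_) (∑-swap xs ys f)) (sym (∑-+ ys _ _))

term≤∑ : ∀ {xs : List I} f {x} → x ∈ xs → f x ≤ ∑ xs f
term≤∑ f (here refl) = m≤m+n _ _
term≤∑ f (there x∈)  = ≤-trans (term≤∑ f x∈) (m≤n+m _ _)

∑-none : ∀ (xs : List I) {f} → (∀ {x} → x ∈ xs → f x ≡ 0) → ∑ xs f ≡ 0
∑-none []       f≡0 = refl
∑-none (x ∷ xs) f≡0 rewrite f≡0 (here refl) = ∑-none xs (f≡0 ∘ there)

∑-atMostOne : ∀ {xs : List I} {f} → Unique xs → (∀ x → f x ≤ 1) →
              (∀ {x y} → 0 < f x → 0 < f y → x ≡ y) → ∑ xs f ≤ 1
∑-atMostOne                         []          f≤1 same = z≤n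
∑-atMostOne {xs = x ∷ xs} {f = f} (x≢ ∷ uniq) f≤1 same with f x in eq
... | zero  = ∑-atMostOne uniq f≤1 same
... | suc n = subst₂ _≤_ (sym (trans (cong (suc n +_) rest≡0) (+-identityʳ (suc n)))) refl
                (subst (_≤ 1) eq (f≤1 x))
  where
  rest≡0 : ∑ xs f ≡ 0
  rest≡0 = ∑-none xs λ {y} y∈ → n≤0⇒n≡0 (≮⇒≥ λ 0<fy →
    All.lookup x≢ y∈ (same (subst (0 <_) (sym eq) (s≤s z≤n)) 0<fy))

∑-++ : ∀ (xs ys : List I) f → ∑ (xs ++ ys) f ≡ ∑ xs f + ∑ ys f
∑-++ []       ys f = refl
∑-++ (x ∷ xs) ys f = trans (cong (f x +_) (∑-++ xs ys f)) (sym (+-assoc (f x) _ _))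

∑-map : ∀ (g : I → H) xs f → ∑ (map g xs) f ≡ ∑ xs (f ∘ g)
∑-map g []       f = refl
∑-map g (x ∷ xs) f = cong (f (g x) +_) (∑-map g xs f)

∑-product : ∀ (g : I → H → L) xs ys f →
            ∑ (cartesianProductWith g xs ys) f ≡ ∑[ x ∈ xs ] ∑[ y ∈ ys ] f (g x y)
∑-product g []       ys f = refl
∑-product g (x ∷ xs) ys f =
  trans (∑-++ (map (g x) ys) _ f) (cong₂ _+_ (∑-map (g x) ys f) (∑-product g xs ys f))

-- The averaging principle by which a good sample is selected later. Strictness matters: it rules
-- out the empty list.
∑<∑⇒∃< : ∀ (xs : List I) {f g} → ∑ xs f < ∑ xs g → ∃ λ x → f x < g x
∑<∑⇒∃< (x ∷ xs) {f} {g} ∑f<∑g with f x <? g x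
... | yes fx<gx = x , fx<gx
... | no  fx≮gx = ∑<∑⇒∃< xs (+-cancelˡ-< (g x) _ _
        (≤-<-trans (+-monoˡ-≤ (∑ xs f) (≮⇒≥ fx≮gx)) ∑f<∑g))

∑-applyUpTo-≥ : ∀ (h : ℕ → I) {f} {k n r} → k ≤ n → (∀ {i} → i < k → r ≤ f (h i)) →
                k * r ≤ ∑ (applyUpTo h n) f
∑-applyUpTo-≥ h z≤n       r≤ = z≤n
∑-applyUpTo-≥ h (s≤s k≤n) r≤ = +-mono-≤ (r≤ (s≤s z≤n)) (∑-applyUpTo-≥ (h ∘ suc) k≤n (r≤ ∘ s≤s))

module _ (os : List I) (K : ℕ) {c : ℕ} where

  -- Linearity of expectation with denominators cleared: a bound on the average of each `f x` over
  -- `os` adds up over `xs` once the two sums are exchanged. Nested uses treat sums over several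
  -- indices.
  ∑∑-≤ : ∀ (xs : List H) {f : H → I → ℕ} → (∀ x → K * ∑ os (f x) ≤ c) →
         K * ∑[ o ∈ os ] ∑[ x ∈ xs ] f x o ≤ length xs * c
  ∑∑-≤ xs {f} f≤ = begin
    K * ∑[ o ∈ os ] ∑[ x ∈ xs ] f x o  ≡⟨ cong (K *_) (∑-swap os xs _) ⟩
    K * ∑[ x ∈ xs ] ∑ os (f x)         ≡⟨ *-∑ K xs _ ⟩
    ∑[ x ∈ xs ] (K * ∑ os (f x))       ≤⟨ ∑-mono xs (λ {x} _ → f≤ x) ⟩
    ∑[ _ ∈ xs ] c                      ≡⟨ ∑-const xs c ⟩
    length xs * c                      ∎
    where open ≤-Reasoning

  ∑∑-≥ : ∀ (xs : List H) {f : H → I → ℕ} → (∀ {x} → x ∈ xs → c ≤ K * ∑ os (f x)) →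
         length xs * c ≤ K * ∑[ o ∈ os ] ∑[ x ∈ xs ] f x o
  ∑∑-≥ xs {f} ≤f = begin
    length xs * c                      ≡⟨ ∑-const xs c ⟨
    ∑[ _ ∈ xs ] c                      ≤⟨ ∑-mono xs ≤f ⟩
    ∑[ x ∈ xs ] (K * ∑ os (f x))       ≡⟨ *-∑ K xs _ ⟨
    K * ∑[ x ∈ xs ] ∑ os (f x)         ≡⟨ cong (K *_) (∑-swap os xs _) ⟨
    K * ∑[ o ∈ os ] ∑[ x ∈ xs ] f x o  ∎
    where open ≤-Reasoning

∑𝟙+length-filter : ∀ {P : I → Set} (P? : Decidable P) xs →
                    ∑[ x ∈ xs ] 𝟙 (P? x) + length (filter (λ x → ¬? (P? x)) xs) ≡ length xs
∑𝟙+length-filter P? []       = refl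
∑𝟙+length-filter P? (x ∷ xs) with P? x
... | yes _ = cong suc (∑𝟙+length-filter P? xs)
... | no  _ = trans (+-suc _ _) (cong suc (∑𝟙+length-filter P? xs))

-- Finite product spaces and the resampling of coordinates

allVecs : List I → ∀ m → List (Vec I m)
allVecs xs zero    = [] ∷ []
allVecs xs (suc m) = cartesianProductWith _∷_ xs (allVecs xs m)

length-allVecs : ∀ (xs : List I) m → length (allVecs xs m) ≡ length xs ^ m
length-allVecs xs m = begin
  length (allVecs xs m)          ≡⟨ *-identityʳ _ ⟨
  length (allVecs xs m) * 1      ≡⟨ ∑-const (allVecs xs m) 1 ⟨
  ∑[ _ ∈ allVecs xs m ] 1        ≡⟨ count m ⟩
  length xs ^ m                  ∎
  where
  open ≡-Reasoning
  count : ∀ m → ∑[ _ ∈ allVecs xs m ] 1 ≡ length xs ^ m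
  count zero    = refl
  count (suc m) = begin
    ∑[ _ ∈ allVecs xs (suc m) ] 1         ≡⟨ ∑-product _∷_ xs (allVecs xs m) _ ⟩
    ∑[ _ ∈ xs ] ∑[ _ ∈ allVecs xs m ] 1   ≡⟨ ∑-const xs _ ⟩
    length xs * ∑[ _ ∈ allVecs xs m ] 1   ≡⟨ cong (length xs *_) (count m) ⟩
    length xs ^ suc m                     ∎

∈-allVecs : ∀ {xs : List I} {m} (v : Vec I m) → (∀ i → lookup v i ∈ xs) → v ∈ allVecs xs m
∈-allVecs []      ∈xs = here refl
∈-allVecs (x ∷ v) ∈xs = ∈-cartesianProductWith⁺ _∷_ (∈xs zero) (∈-allVecs v (∈xs ∘ suc))

allVecs-unique : ∀ {xs : List I} → Unique xs → ∀ m → Unique (allVecs xs m)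
allVecs-unique uniq zero    = [] ∷ []
allVecs-unique uniq (suc m) =
  Unique.cartesianProductWith⁺ _∷_ ∷-injective uniq (allVecs-unique uniq m)

-- Redrawing one coordinate preserves the uniform law: on the right each vector arises from
-- `length xs` choices of the overwritten entry, its own entry at `a` being the redrawn one.
∑-resample : ∀ (xs : List I) {m} (a : Fin m) f →
             length xs * ∑ (allVecs xs m) f ≡ ∑[ q ∈ allVecs xs m ] ∑[ x ∈ xs ] f (q [ a ]≔ x)
∑-resample xs {suc m} zero f = begin
  length xs * ∑ (allVecs xs (suc m)) f                      ≡⟨ cong (length xs *_) (∑-product _∷_ xs qs f) ⟩
  length xs * ∑[ x ∈ xs ] ∑[ q ∈ qs ] f (x ∷ q)             ≡⟨ cong (length xs *_) (∑-swap xs qs _) ⟩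
  length xs * ∑[ q ∈ qs ] ∑[ x ∈ xs ] f (x ∷ q)             ≡⟨ ∑-const xs _ ⟨
  ∑[ _ ∈ xs ] ∑[ q ∈ qs ] ∑[ x ∈ xs ] f (x ∷ q)             ≡⟨ ∑-product _∷_ xs qs _ ⟨
  ∑[ q ∈ allVecs xs (suc m) ] ∑[ x ∈ xs ] f (q [ zero ]≔ x) ∎
  where
  open ≡-Reasoning
  qs = allVecs xs m
∑-resample xs {suc m} (suc a) f = begin
  length xs * ∑ (allVecs xs (suc m)) f                      ≡⟨ cong (length xs *_) (∑-product _∷_ xs qs f) ⟩
  length xs * ∑[ x ∈ xs ] ∑[ q ∈ qs ] f (x ∷ q)             ≡⟨ *-∑ (length xs) xs _ ⟩
  ∑[ x ∈ xs ] (length xs * ∑[ q ∈ qs ] f (x ∷ q))           ≡⟨ ∑-cong xs (λ x → ∑-resample xs a (f ∘ (x ∷_))) ⟩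
  ∑[ x ∈ xs ] ∑[ q ∈ qs ] ∑[ y ∈ xs ] f (x ∷ q [ a ]≔ y)    ≡⟨ ∑-product _∷_ xs qs _ ⟨
  ∑[ q ∈ allVecs xs (suc m) ] ∑[ x ∈ xs ] f (q [ suc a ]≔ x) ∎
  where
  open ≡-Reasoning
  qs = allVecs xs m

-- Once both coordinates are redrawn, the others can be held fixed, and `determined` leaves at most
-- one pair of values. So the event has probability at most 1/|xs|².
∑-determined : ∀ {xs : List I} → Unique xs →
               ∀ {m} (a c : Fin m) {P : Vec I m → Set} (P? : Decidable P) →
               (∀ q {x y x′ y′} → P (q [ a ]≔ x [ c ]≔ y) → P (q [ a ]≔ x′ [ c ]≔ y′) →
                x ≡ x′ × y ≡ y′) →
               length xs * length xs * ∑[ q ∈ allVecs xs m ] 𝟙 (P? q) ≤ length (allVecs xs m)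
∑-determined {xs = xs} uniq {m} a c P? determined = begin
  n * n * ∑[ q ∈ Ω ] 𝟙 (P? q)                                       ≡⟨ *-assoc n n _ ⟩
  n * (n * ∑[ q ∈ Ω ] 𝟙 (P? q))                                     ≡⟨ cong (n *_) (∑-resample xs c _) ⟩
  n * ∑[ q ∈ Ω ] ∑[ y ∈ xs ] 𝟙 (P? (q [ c ]≔ y))                    ≡⟨ ∑-resample xs a _ ⟩
  ∑[ q ∈ Ω ] ∑[ x ∈ xs ] ∑[ y ∈ xs ] 𝟙 (P? (q [ a ]≔ x [ c ]≔ y))   ≤⟨ ∑-mono Ω (λ {q} _ → outer q) ⟩
  ∑[ _ ∈ Ω ] 1                                                      ≡⟨ ∑-const Ω 1 ⟩
  length Ω * 1                                                      ≡⟨ *-identityʳ _ ⟩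
  length Ω                                                          ∎
  where
  open ≤-Reasoning
  n = length xs
  Ω = allVecs xs m
  positive-term : ∀ (ys : List I) {f} → 0 < ∑ ys f → ∃ λ y → 0 < f y
  positive-term ys {f} 0<∑ = ∑<∑⇒∃< ys
    (subst (_< ∑ ys f) (sym (trans (∑-const ys 0) (*-zeroʳ (length ys)))) 0<∑)
  inner : ∀ q x → ∑[ y ∈ xs ] 𝟙 (P? (q [ a ]≔ x [ c ]≔ y)) ≤ 1
  inner q x = ∑-atMostOne uniq (λ y → 𝟙≤1 (P? (q [ a ]≔ x [ c ]≔ y)))
    λ p p′ → proj₂ (determined q (𝟙-pos (P? _) p) (𝟙-pos (P? _) p′))
  outer : ∀ q → ∑[ x ∈ xs ] ∑[ y ∈ xs ] 𝟙 (P? (q [ a ]≔ x [ c ]≔ y)) ≤ 1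
  outer q = ∑-atMostOne uniq (inner q) λ p p′ →
    proj₁ (determined q (𝟙-pos (P? _) (proj₂ (positive-term xs p)))
                        (𝟙-pos (P? _) (proj₂ (positive-term xs p′))))

-- Random extension of a finite Sidon set

-- The Sidon property for unordered pairs. Without order hypotheses the four elements can be
-- permuted freely, which the case analysis for the extended set relies on.
SumsAreUnique : (ℕ → Set) → Set
SumsAreUnique P = ∀ {a b c d} → P a → P b → P c → P d → a + b ≡ c + d →
                  (a ≡ c × b ≡ d) ⊎ (a ≡ d × b ≡ c)

FourSum : (ℕ → Set) → ℕ → Set
FourSum P u = ∃ λ a₁ → ∃ λ a₂ → ∃ λ a₃ → ∃ λ a₄ →
              P a₁ × P a₂ × P a₃ × P a₄ × (u ≡ a₁ + a₂ + a₃ + a₄)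

lookup-separates : ∀ {A : Set} → DecidableEquality A → ∀ {m} (v w : Vec A m) → v ≢ w →
                   ∃ λ g → lookup v g ≢ lookup w g
lookup-separates _≟_ []      []      v≢w = contradiction refl v≢w
lookup-separates _≟_ (x ∷ v) (y ∷ w) v≢w with x ≟ y
... | no  x≢y  = zero , x≢y
... | yes refl with g , vg≢wg ← lookup-separates _≟_ v w (v≢w ∘ cong (x ∷_)) = suc g , vg≢wg

length-allFin : ∀ m → length (allFin m) ≡ m
length-allFin m = length-tabulate id

module RandomExtension (n s : ℕ) (B : List ℕ) where

  -- Symbols name positions rather than values, so draws that happen to be equal stay apart. The
  -- `4 * s` positions form four groups of `s`, and a `Quad` picks one position in each group.
  Index Symbol Sample Quad : Set
  Index  = Fin (4 * s)
  Symbol = Index ⊎ ℕ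
  Sample = Vec ℕ (4 * s)
  Quad   = Vec (Fin s) 4

  Ω : List Sample
  Ω = allVecs (upTo n) (4 * s)

  symbols : List Symbol
  symbols = map inj₁ (allFin (4 * s)) ++ map inj₂ B

  quads : List Quad
  quads = allVecs (allFin s) 4

  triples : List (Vec Symbol 3)
  triples = allVecs symbols 3

  value : Sample → Symbol → ℕ
  value q (inj₁ i) = suc (lookup q i)
  value q (inj₂ b) = b

  index : Quad → Fin 4 → Index
  index t g = combine g (lookup t g)

  total : Sample → Quad → ℕ
  total q t = ∑[ g ∈ allFin 4 ] value q (inj₁ (index t g))

  -- Non-triviality is a condition on symbols: `β` and `γ` differ from draw `i`, while `α` may be
  -- `i` itself. In particular a draw that repeats the value of another symbol σ of `symbols` is
  -- bad, by the choice α = β = γ = σ.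
  Violates : Sample → Index → Vec Symbol 3 → Set
  Violates q i (α ∷ β ∷ γ ∷ []) =
    β ≢ inj₁ i × γ ≢ inj₁ i × value q (inj₁ i) + value q α ≡ value q β + value q γ

  Bad : Sample → Index → Set
  Bad q i = Any (Violates q i) triples

  Covers : Sample → ℕ → Quad → Set
  Covers q u t = total q t ≡ u × (∀ g → ¬ Bad q (index t g))

  Covered : Sample → ℕ → Set
  Covered q u = Any (Covers q u) quads

  _≟ₛ_ : DecidableEquality Symbol
  _≟ₛ_ = Sum.≡-dec Fin._≟_ _≟_

  _≟ᵥ_ : DecidableEquality Quad
  _≟ᵥ_ = ≡-dec Fin._≟_

  violates? : ∀ q i → Decidable (Violates q i)
  violates? q i (α ∷ β ∷ γ ∷ []) = ¬? (β ≟ₛ inj₁ i) ×-dec ¬? (γ ≟ₛ inj₁ i) ×-dec (_ ≟ _)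

  bad? : ∀ q → Decidable (Bad q)
  bad? q i = any? (violates? q i) triples

  good? : ∀ q → Decidable (λ i → ¬ Bad q i)
  good? q i = ¬? (bad? q i)

  covers? : ∀ q u → Decidable (Covers q u)
  covers? q u t = (total q t ≟ u) ×-dec Fin.all? (λ g → good? q (index t g))

  covered? : ∀ q → Decidable (Covered q)
  covered? q u = any? (covers? q u) quads

  index-injective : ∀ t t′ g g′ → index t g ≡ index t′ g′ → g ≡ g′ × lookup t g ≡ lookup t′ g′
  index-injective t t′ g g′ eq =
    Fin.combine-injectiveˡ g _ g′ _ eq , Fin.combine-injectiveʳ g _ g′ _ eq

  module _ (q : Sample) {a c : Index} (a≢c : a ≢ c) where

    at : ℕ → ℕ → Sample
    at x y = q [ a ]≔ x [ c ]≔ y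

    value-a : ∀ x y → value (at x y) (inj₁ a) ≡ suc x
    value-a x y = cong suc (trans (lookup∘update′ a≢c (q [ a ]≔ x) y) (lookup∘update a q x))

    value-c : ∀ x y → value (at x y) (inj₁ c) ≡ suc y
    value-c x y = cong suc (lookup∘update c (q [ a ]≔ x) y)

    -- Each inequality is required only if `σ` reads that coordinate. Hence one coordinate may fall
    -- while the other rises, provided that `σ` ignores the falling one.
    value-mono : ∀ σ {x y x′ y′} → (σ ≡ inj₁ a → x ≤ x′) → (σ ≡ inj₁ c → y ≤ y′) →
                 value (at x y) σ ≤ value (at x′ y′) σ
    value-mono (inj₂ b) x≤x′ y≤y′ = ≤-refl
    value-mono (inj₁ i) {x} {y} {x′} {y′} x≤x′ y≤y′ with i Fin.≟ a | i Fin.≟ c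
    ... | yes refl | _        = subst₂ _≤_ (sym (value-a x y)) (sym (value-a x′ y′)) (s≤s (x≤x′ refl))
    ... | no  _    | yes refl = subst₂ _≤_ (sym (value-c x y)) (sym (value-c x′ y′)) (s≤s (y≤y′ refl))
    ... | no  i≢a  | no  i≢c  = ≤-reflexive (cong suc (trans (other x y) (sym (other x′ y′))))
      where
      other : ∀ x y → lookup (at x y) i ≡ lookup q i
      other x y = trans (lookup∘update′ i≢c (q [ a ]≔ x) y) (lookup∘update′ i≢a q x)

    value-mono-<-a : ∀ x y x′ y′ → x < x′ → value (at x y) (inj₁ a) < value (at x′ y′) (inj₁ a)
    value-mono-<-a x y x′ y′ x<x′ = subst₂ _<_ (sym (value-a x y)) (sym (value-a x′ y′)) (s≤s x<x′)

    value-mono-<-c : ∀ x y x′ y′ → y < y′ → value (at x y) (inj₁ c) < value (at x′ y′) (inj₁ c)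
    value-mono-<-c x y x′ y′ y<y′ = subst₂ _<_ (sym (value-c x y)) (sym (value-c x′ y′)) (s≤s y<y′)

    total-mono-< : ∀ t x y x′ y′ →
                   (∀ g → index t g ≡ a → x ≤ x′) → (∀ g → index t g ≡ c → y ≤ y′) →
                   ∀ g → (index t g ≡ a × x < x′) ⊎ (index t g ≡ c × y < y′) →
                   total (at x y) t < total (at x′ y′) t
    total-mono-< t x y x′ y′ x≤x′ y≤y′ g strict = ∑-mono-< (allFin 4)
      {λ g → value (at x y) (inj₁ (index t g))} {λ g → value (at x′ y′) (inj₁ (index t g))}
      (λ {g} _ → value-mono (inj₁ (index t g)) (x≤x′ g ∘ Sum.inj₁-injective) (y≤y′ g ∘ Sum.inj₁-injective))
      (∈-allFin g) (raised strict)
      where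
      raised : (index t g ≡ a × x < x′) ⊎ (index t g ≡ c × y < y′) →
               value (at x y) (inj₁ (index t g)) < value (at x′ y′) (inj₁ (index t g))
      raised (inj₁ (eq , x<x′)) = subst (λ i → value (at x y) (inj₁ i) < value (at x′ y′) (inj₁ i)) (sym eq)
        (value-mono-<-a x y x′ y′ x<x′)
      raised (inj₂ (eq , y<y′)) = subst (λ i → value (at x y) (inj₁ i) < value (at x′ y′) (inj₁ i)) (sym eq)
        (value-mono-<-c x y x′ y′ y<y′)

  -- Two equations determine two draws

  TwoQuads : ℕ → Quad → Quad → Sample → Set
  TwoQuads u t t′ q = t ≢ t′ × total q t ≡ u × total q t′ ≡ u

  twoQuads? : ∀ u t t′ → Decidable (TwoQuads u t t′)
  twoQuads? u t t′ q = ¬? (t ≟ᵥ t′) ×-dec (_ ≟ _) ×-dec (_ ≟ _)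

  BadQuad : ℕ → Quad → Fin 4 → Vec Symbol 3 → Sample → Set
  BadQuad u t g w q = total q t ≡ u × Violates q (index t g) w

  badQuad? : ∀ u t g w → Decidable (BadQuad u t g w)
  badQuad? u t g w q = (_ ≟ _) ×-dec violates? q (index t g) w

  private
    equal-by : ∀ {x y} → ¬ (x < y) → ¬ (y < x) → x ≡ y
    equal-by x≮y y≮x = ≤-antisym (≮⇒≥ y≮x) (≮⇒≥ x≮y)

  -- Every quadruple uses one position per group, so in group `g` the position of `t` is absent from
  -- `t′` and vice versa. The sum over `t` therefore ignores `y` and fixes `x`, and the sum over
  -- `t′` ignores `x` and fixes `y`, both by strict monotonicity.
  twoQuads-determined : ∀ u t t′ g → lookup t g ≢ lookup t′ g → ∀ q {x y x′ y′} →
    TwoQuads u t t′ (q [ index t g ]≔ x [ index t′ g ]≔ y) →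
    TwoQuads u t t′ (q [ index t g ]≔ x′ [ index t′ g ]≔ y′) → x ≡ x′ × y ≡ y′
  twoQuads-determined u t t′ g tg≢t′g q {x} {y} {x′} {y′} (_ , p , r) (_ , p′ , r′) =
    equal-by (x≮ x y x′ y′ p p′) (x≮ x′ y′ x y p′ p) , equal-by (y≮ x y x′ y′ r r′) (y≮ x′ y′ x y r′ r)
    where
    a≢c : index t g ≢ index t′ g
    a≢c = tg≢t′g ∘ proj₂ ∘ index-injective t t′ g g
    a∉t′ : ∀ g′ → index t′ g′ ≢ index t g
    a∉t′ g′ eq with refl , eq′ ← index-injective t′ t g′ g eq = tg≢t′g (sym eq′)
    c∉t : ∀ g′ → index t g′ ≢ index t′ g
    c∉t g′ eq with refl , eq′ ← index-injective t t′ g′ g eq = tg≢t′g eq′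
    x≮ : ∀ x y x′ y′ → total (at q a≢c x y) t ≡ u → total (at q a≢c x′ y′) t ≡ u → ¬ (x < x′)
    x≮ x y x′ y′ p p′ x<x′ = <⇒≢ (total-mono-< q a≢c t x y x′ y′ (λ _ _ → <⇒≤ x<x′)
      (λ g′ eq → contradiction eq (c∉t g′)) g (inj₁ (refl , x<x′))) (trans p (sym p′))
    y≮ : ∀ x y x′ y′ → total (at q a≢c x y) t′ ≡ u → total (at q a≢c x′ y′) t′ ≡ u → ¬ (y < y′)
    y≮ x y x′ y′ p p′ y<y′ = <⇒≢ (total-mono-< q a≢c t′ x y x′ y′
      (λ g′ eq → contradiction eq (a∉t′ g′)) (λ _ _ → <⇒≤ y<y′) g (inj₂ (refl , y<y′))) (trans p (sym p′))

  -- Along total = u, raising coordinate g lowers coordinate g′; when α is not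
  -- the symbol of g′ this raises the left side of the violated equation and
  -- does not raise the right side.
  badQuad-determined : ∀ u t {g g′} w → g ≢ g′ → lookup w zero ≢ inj₁ (index t g′) → ∀ q {x y x′ y′} →
    BadQuad u t g w (q [ index t g ]≔ x [ index t g′ ]≔ y) →
    BadQuad u t g w (q [ index t g ]≔ x′ [ index t g′ ]≔ y′) → x ≡ x′ × y ≡ y′
  badQuad-determined u t {g} {g′} (α ∷ β ∷ γ ∷ []) g≢g′ α≢c q {x} {y} {x′} {y′}
    (p , β≢a , γ≢a , e) (p′ , _ , _ , e′) =
    x≡x′ , equal-by (y≮ x y x′ y′ x≡x′ p p′) (y≮ x′ y′ x y (sym x≡x′) p′ p)
    where
    a≢c : index t g ≢ index t g′
    a≢c = g≢g′ ∘ proj₁ ∘ index-injective t t g g′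
    v : ℕ → ℕ → Symbol → ℕ
    v x y = value (at q a≢c x y)
    Holds : ℕ → ℕ → Set
    Holds x y = v x y (inj₁ (index t g)) + v x y α ≡ v x y β + v x y γ
    x≮ : ∀ x y x′ y′ → Holds x y → Holds x′ y′ →
         total (at q a≢c x y) t ≡ u → total (at q a≢c x′ y′) t ≡ u → ¬ (x < x′)
    x≮ x y x′ y′ e e′ p p′ x<x′ with y <? suc y′
    ... | yes (s≤s y≤y′) = <⇒≢ (total-mono-< q a≢c t x y x′ y′ (λ _ _ → <⇒≤ x<x′) (λ _ _ → y≤y′)
            g (inj₁ (refl , x<x′))) (trans p (sym p′))
    ... | no  y≰y′ = <⇒≱ left right
      where
      y′≤y : y′ ≤ y
      y′≤y = <⇒≤ (≮⇒≥ y≰y′)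
      left : v x y (inj₁ (index t g)) + v x y α < v x′ y′ (inj₁ (index t g)) + v x′ y′ α
      left = +-mono-<-≤ (value-mono-<-a q a≢c x y x′ y′ x<x′)
               (value-mono q a≢c α (λ _ → <⇒≤ x<x′) (λ eq → contradiction eq α≢c))
      falls : ∀ {σ} → σ ≢ inj₁ (index t g) → v x′ y′ σ ≤ v x y σ
      falls {σ} σ≢a = value-mono q a≢c σ (λ eq → contradiction eq σ≢a) (λ _ → y′≤y)
      right : v x′ y′ (inj₁ (index t g)) + v x′ y′ α ≤ v x y (inj₁ (index t g)) + v x y α
      right = subst₂ _≤_ (sym e′) (sym e) (+-mono-≤ (falls β≢a) (falls γ≢a))
    x≡x′ : x ≡ x′
    x≡x′ = equal-by (x≮ x y x′ y′ e e′ p p′) (x≮ x′ y′ x y e′ e p′ p)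
    y≮ : ∀ x y x′ y′ → x ≡ x′ →
         total (at q a≢c x y) t ≡ u → total (at q a≢c x′ y′) t ≡ u → ¬ (y < y′)
    y≮ x y x′ y′ x≡x′ p p′ y<y′ = <⇒≢ (total-mono-< q a≢c t x y x′ y′ (λ _ _ → ≤-reflexive x≡x′)
      (λ _ _ → <⇒≤ y<y′) g′ (inj₂ (refl , y<y′))) (trans p (sym p′))

  -- Supplies the second coordinate for `badQuad-determined`. The positions of `t` in different
  -- groups are distinct, so `σ` equals at most one of them, and trying two groups other than `g`
  -- suffices.
  partner : ∀ t g σ → ∃ λ g′ → g ≢ g′ × σ ≢ inj₁ (index t g′)
  partner t g σ with σ ≟ₛ inj₁ (index t (punchIn g zero))
  ... | no  σ≢   = punchIn g zero , Fin.punchInᵢ≢i g zero ∘ sym , σ≢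
  ... | yes refl = punchIn g (suc zero) , Fin.punchInᵢ≢i g (suc zero) ∘ sym , λ eq →
    contradiction (Fin.punchIn-injective g zero (suc zero)
      (proj₁ (index-injective t t (punchIn g zero) (punchIn g (suc zero)) (Sum.inj₁-injective eq)))) λ ()

  determined-rare : ∀ a c {P : Sample → Set} (P? : Decidable P) →
    (∀ q {x y x′ y′} → P (q [ a ]≔ x [ c ]≔ y) → P (q [ a ]≔ x′ [ c ]≔ y′) →
     x ≡ x′ × y ≡ y′) →
    n * n * ∑[ q ∈ Ω ] 𝟙 (P? q) ≤ length Ω
  determined-rare a c P? determined =
    subst (λ k → k * k * ∑[ q ∈ Ω ] 𝟙 (P? q) ≤ length Ω) (length-upTo n)
      (∑-determined (Unique.upTo⁺ n) a c P? determined)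

  twoQuads-rare : ∀ u t t′ → n * n * ∑[ q ∈ Ω ] 𝟙 (twoQuads? u t t′ q) ≤ length Ω
  twoQuads-rare u t t′ with t ≟ᵥ t′
  -- A quadruple does not coincide with itself, so the event is empty.
  ... | yes t≡t′ = ≤-trans (≤-reflexive (trans (cong (n * n *_) (∑-none Ω λ _ → refl)) (*-zeroʳ (n * n)))) z≤n
  ... | no  t≢t′ with g , tg≢t′g ← lookup-separates Fin._≟_ t t′ t≢t′ =
    determined-rare (index t g) (index t′ g) (λ q → ¬? (no t≢t′) ×-dec (_ ≟ _) ×-dec (_ ≟ _))
      (twoQuads-determined u t t′ g tg≢t′g)

  badQuad-rare : ∀ u t g w → n * n * ∑[ q ∈ Ω ] 𝟙 (badQuad? u t g w q) ≤ length Ω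
  badQuad-rare u t g w with g′ , g≢g′ , α≢ ← partner t g (lookup w zero) =
    determined-rare (index t g) (index t g′) (badQuad? u t g w) (badQuad-determined u t w g≢g′ α≢)

  -- The probability that a fixed point is covered

  representations : Sample → ℕ → ℕ
  representations q u = ∑[ t ∈ quads ] 𝟙 (total q t ≟ u)

  badRepresentations : Sample → ℕ → ℕ
  badRepresentations q u = ∑[ t ∈ quads ] ∑[ g ∈ allFin 4 ] ∑[ w ∈ triples ] 𝟙 (badQuad? u t g w q)

  coincidences : Sample → ℕ → ℕ
  coincidences q u = ∑[ t ∈ quads ] ∑[ t′ ∈ quads ] 𝟙 (twoQuads? u t t′ q)

  quads-complete : ∀ t → t ∈ quads
  quads-complete t = ∈-allVecs t λ g → ∈-allFin _

  -- If some `t₀` covers `u`, every representation is `t₀` itself or forms a coincidence with it. If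
  -- nothing covers `u`, every representation contains a bad draw and is charged to an equation
  -- which that draw violates.
  representations-bound : ∀ q u →
    representations q u ≤ 𝟙 (covered? q u) + badRepresentations q u + coincidences q u
  representations-bound q u with covered? q u
  ... | yes covered with t₀ , _ , t₀-sums , _ ← find covered = begin
    representations q u                                                         ≤⟨ ∑-mono quads (λ {t} _ → split t) ⟩
    ∑[ t ∈ quads ] (𝟙 (t₀ ≟ᵥ t) + 𝟙 (twoQuads? u t₀ t q))                       ≡⟨ ∑-+ quads _ _ ⟩
    ∑[ t ∈ quads ] 𝟙 (t₀ ≟ᵥ t) + ∑[ t ∈ quads ] 𝟙 (twoQuads? u t₀ t q)          ≤⟨ +-mono-≤ once double-count ⟩
    1 + coincidences q u                                                        ≤⟨ +-monoˡ-≤ _ (m≤m+n 1 _) ⟩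
    1 + badRepresentations q u + coincidences q u                               ∎
    where
    open ≤-Reasoning
    double-count : ∑[ t ∈ quads ] 𝟙 (twoQuads? u t₀ t q) ≤ coincidences q u
    double-count = term≤∑ (λ t → ∑[ t′ ∈ quads ] 𝟙 (twoQuads? u t t′ q)) (quads-complete t₀)
    split : ∀ t → 𝟙 (total q t ≟ u) ≤ 𝟙 (t₀ ≟ᵥ t) + 𝟙 (twoQuads? u t₀ t q)
    split t with total q t ≟ u | t₀ ≟ᵥ t
    ... | no  _      | _         = z≤n
    ... | yes _      | yes _     = m≤m+n 1 _
    ... | yes t-sums | no  t₀≢t  =
      𝟙-yes (¬? (no t₀≢t) ×-dec (total q t₀ ≟ u) ×-dec yes t-sums) (t₀≢t , t₀-sums , t-sums)
    once : ∑[ t ∈ quads ] 𝟙 (t₀ ≟ᵥ t) ≤ 1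
    once = ∑-atMostOne (allVecs-unique (Unique.allFin⁺ s) 4) (λ t → 𝟙≤1 (t₀ ≟ᵥ t))
      λ p p′ → trans (sym (𝟙-pos (_ ≟ᵥ _) p)) (𝟙-pos (_ ≟ᵥ _) p′)
  ... | no uncovered = ≤-trans (∑-mono quads (λ {t} → charge t)) (m≤m+n _ _)
    where
    charge : ∀ t → t ∈ quads → 𝟙 (total q t ≟ u) ≤ ∑[ g ∈ allFin 4 ] ∑[ w ∈ triples ] 𝟙 (badQuad? u t g w q)
    charge t t∈ with total q t ≟ u
    ... | no  _    = z≤n
    ... | yes sums with g , ¬good ← Fin.¬∀⟶∃¬ 4 _ (λ g → good? q (index t g))
                                (λ good → uncovered (lose t∈ (sums , good)))
      with w , w∈ , viol ← find (decidable-stable (bad? q (index t g)) ¬good) = begin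
      1                                       ≤⟨ 𝟙-yes (bad-at g w) (sums , viol) ⟩
      𝟙 (bad-at g w)                          ≤⟨ term≤∑ (λ w → 𝟙 (bad-at g w)) w∈ ⟩
      ∑[ w ∈ triples ] 𝟙 (bad-at g w)         ≤⟨ term≤∑ (λ g → ∑[ w ∈ triples ] 𝟙 (bad-at g w)) (∈-allFin g) ⟩
      ∑[ g ∈ allFin 4 ] ∑[ w ∈ triples ] 𝟙 (bad-at g w) ∎
      where
      open ≤-Reasoning
      bad-at : ∀ g w → Dec (BadQuad u t g w q)
      bad-at g w = yes sums ×-dec violates? q (index t g) w

  spread : Quad → Sample → ℕ → ℕ → ℕ → ℕ → Sample
  spread t q x y z w = q [ index t 0F ]≔ x [ index t 1F ]≔ y [ index t 2F ]≔ z [ index t 3F ]≔ w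

  index-apart : ∀ t g g′ → g ≢ g′ → index t g ≢ index t g′
  index-apart t g g′ g≢g′ = g≢g′ ∘ proj₁ ∘ index-injective t t g g′

  total-spread : ∀ t q x y z w → total (spread t q x y z w) t ≡ suc x + (suc y + (suc z + suc w))
  total-spread t q x y z w = cong₂ _+_ value₀ (cong₂ _+_ value₁ (cong₂ _+_ value₂ (trans (+-identityʳ _) value₃)))
    where
    i : Fin 4 → Index
    i = index t
    q₀ = q [ i 0F ]≔ x
    q₁ = q₀ [ i 1F ]≔ y
    q₂ = q₁ [ i 2F ]≔ z
    q₃ = q₂ [ i 3F ]≔ w
    keep : ∀ g g′ → g ≢ g′ → ∀ (q : Sample) w → lookup (q [ i g′ ]≔ w) (i g) ≡ lookup q (i g)
    keep g g′ g≢g′ q w = lookup∘update′ (index-apart t g g′ g≢g′) q w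
    value₀ : value q₃ (inj₁ (i 0F)) ≡ suc x
    value₀ = cong suc (trans (keep 0F 3F (λ ()) q₂ w) (trans (keep 0F 2F (λ ()) q₁ z)
               (trans (keep 0F 1F (λ ()) q₀ y) (lookup∘update (i 0F) q x))))
    value₁ : value q₃ (inj₁ (i 1F)) ≡ suc y
    value₁ = cong suc (trans (keep 1F 3F (λ ()) q₂ w) (trans (keep 1F 2F (λ ()) q₁ z) (lookup∘update (i 1F) q₀ y)))
    value₂ : value q₃ (inj₁ (i 2F)) ≡ suc z
    value₂ = cong suc (trans (keep 2F 3F (λ ()) q₂ w) (lookup∘update (i 2F) q₁ z))
    value₃ : value q₃ (inj₁ (i 3F)) ≡ suc w
    value₃ = cong suc (lookup∘update (i 3F) q₂ w)

  resample : ∀ a f → n * ∑ Ω f ≡ ∑[ q ∈ Ω ] ∑[ x ∈ upTo n ] f (q [ a ]≔ x)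
  resample a f = subst (λ k → k * ∑ Ω f ≡ ∑[ q ∈ Ω ] ∑[ x ∈ upTo n ] f (q [ a ]≔ x))
                   (length-upTo n) (∑-resample (upTo n) a f)

  -- All four draws of `t` are redrawn. The first three may be any of the k³ choices below `k`; as
  -- 4k ≤ u ≤ n, the last can then be chosen within range to make the total `u`. So at least k³ of
  -- the n⁴ outcomes succeed.
  total-hits : ∀ {k u} → k ≤ n → 4 ≤ k → 4 * k ≤ u → u ≤ n → ∀ t →
               k ^ 3 * length Ω ≤ n * n * (n * n) * ∑[ q ∈ Ω ] 𝟙 (total q t ≟ u)
  total-hits {k} {u} k≤n 4≤k 4k≤u u≤n t = begin
    k ^ 3 * length Ω                                            ≡⟨ *-comm (k ^ 3) (length Ω) ⟩
    length Ω * k ^ 3                                            ≡⟨ ∑-const Ω (k ^ 3) ⟨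
    ∑[ q ∈ Ω ] (k ^ 3)                                          ≤⟨ ∑-mono Ω (λ {q} _ → many q) ⟩
    ∑[ q ∈ Ω ] ∑[ x ∈ V ] ∑[ y ∈ V ] ∑[ z ∈ V ] ∑[ w ∈ V ] hit (spread t q x y z w)
                                                                ≡⟨ resample (i 0F) _ ⟨
    n * (∑[ q ∈ Ω ] ∑[ y ∈ V ] ∑[ z ∈ V ] ∑[ w ∈ V ] hit (q [ i 1F ]≔ y [ i 2F ]≔ z [ i 3F ]≔ w))
                                                                ≡⟨ cong (n *_) (resample (i 1F) _) ⟨
    n * (n * (∑[ q ∈ Ω ] ∑[ z ∈ V ] ∑[ w ∈ V ] hit (q [ i 2F ]≔ z [ i 3F ]≔ w)))
                                                                ≡⟨ cong (λ e → n * (n * e)) (resample (i 2F) _) ⟨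
    n * (n * (n * (∑[ q ∈ Ω ] ∑[ w ∈ V ] hit (q [ i 3F ]≔ w))))
                                                                ≡⟨ cong (λ e → n * (n * (n * e))) (resample (i 3F) hit) ⟨
    n * (n * (n * (n * ∑ Ω hit)))                               ≡⟨ reassociate n (∑ Ω hit) ⟩
    n * n * (n * n) * ∑ Ω hit                                   ∎
    where
    open ≤-Reasoning
    V = upTo n
    i = index t
    hit : Sample → ℕ
    hit q = 𝟙 (total q t ≟ u)
    reassociate : ∀ n e → n * (n * (n * (n * e))) ≡ n * n * (n * n) * e
    reassociate = solve-∀
    last : ∀ q {x y z} → x < k → y < k → z < k → 1 ≤ ∑[ w ∈ V ] hit (spread t q x y z w)
    last q {x} {y} {z} x<k y<k z<k =
      ≤-trans (𝟙-yes (total (spread t q x y z w) t ≟ u) sums)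
        (term≤∑ (λ w → hit (spread t q x y z w)) (∈-upTo⁺ w<n))
      where
      small : suc (suc x + (suc y + suc z)) ≤ u
      small = begin
        1 + (suc x + (suc y + suc z))  ≤⟨ +-mono-≤ (≤-trans (s≤s z≤n) 4≤k) (+-mono-≤ x<k (+-mono-≤ y<k z<k)) ⟩
        k + (k + (k + k))              ≡⟨ cong (λ e → k + (k + (k + e))) (+-identityʳ k) ⟨
        4 * k                          ≤⟨ 4k≤u ⟩
        u                              ∎
      -- The outermost `suc` is there because the fourth draw has value `suc w`.
      w = u ∸ suc (suc x + (suc y + suc z))
      w<n : w < n
      w<n = <-≤-trans (∸-monoʳ-< (s≤s z≤n) small) u≤n
      reorder : ∀ x y z w → suc x + (suc y + (suc z + suc w)) ≡ suc (suc x + (suc y + suc z)) + w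
      reorder = solve-∀
      sums : total (spread t q x y z w) t ≡ u
      sums = trans (total-spread t q x y z w) (trans (reorder x y z w) (m+[n∸m]≡n small))
    many : ∀ q → k ^ 3 ≤ ∑[ x ∈ V ] ∑[ y ∈ V ] ∑[ z ∈ V ] ∑[ w ∈ V ] hit (spread t q x y z w)
    many q = ∑-applyUpTo-≥ id k≤n λ x<k → ∑-applyUpTo-≥ id k≤n λ y<k → ∑-applyUpTo-≥ id k≤n λ z<k →
      last q x<k y<k z<k

  length-quads : length quads ≡ s ^ 4
  length-quads = trans (length-allVecs (allFin s) 4) (cong (_^ 4) (length-allFin s))

  length-symbols : length symbols ≡ length B + 4 * s
  length-symbols = trans (length-++ (map inj₁ (allFin (4 * s))))
    (trans (cong₂ _+_ (trans (length-map inj₁ (allFin (4 * s))) (length-allFin (4 * s))) (length-map inj₂ B))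
      (+-comm (4 * s) (length B)))

  length-triples : length triples ≡ (length B + 4 * s) ^ 3
  length-triples = trans (length-allVecs symbols 3) (cong (_^ 3) length-symbols)

  module _ {k D u : ℕ} (k≤n : k ≤ n) (4≤k : 4 ≤ k) (4k≤u : 4 * k ≤ u) (u≤n : u ≤ n) (0<s : 0 < s)
           (budget : 2 * (n * n * (4 * (length B + 4 * s) ^ 3 + s ^ 4)) ≤ k ^ 3)
           (density : 2 * (n * n * (n * n)) ≤ D * (s ^ 4 * k ^ 3)) where

    -- By `hits` the mean number of representations is at least s⁴k³/n⁴. By `E≤` and `P≤` the two
    -- error terms have total mean at most s⁴(4(|B| + 4s)³ + s⁴)/n², which `budget` makes at most
    -- half of that; by `density` the other half is at least 1/D.
    coverage : length Ω ≤ D * ∑[ q ∈ Ω ] 𝟙 (covered? q u)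
    -- The main term is doubled: one copy of `X * ω` pays for the errors, the other survives the
    -- cancellation.
    coverage = *-cancelˡ-≤ (s ^ 4 * k ^ 3) {{>-nonZero X>0}} (+-cancelʳ-≤ (s ^ 4 * k ^ 3 * length Ω) _ _ (begin
      X * ω + X * ω                                  ≡⟨ double (X * ω) ⟩
      2 * (X * ω)                                    ≤⟨ *-monoʳ-≤ 2 hits ⟩
      2 * (N * N * R)                                ≤⟨ *-monoʳ-≤ 2 (*-monoʳ-≤ (N * N) R≤) ⟩
      2 * (N * N * (C + E + P))                      ≡⟨ expand N C E P ⟩
      2 * (N * N) * C + 2 * (N * (N * E + N * P))    ≤⟨ +-mono-≤ (*-monoˡ-≤ C density)
                                                       (*-monoʳ-≤ 2 (*-monoʳ-≤ N (+-mono-≤ E≤ P≤))) ⟩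
      D * X * C + 2 * (N * (S * (4 * (T * ω)) + S * (S * ω))) ≡⟨ collect D X C N S T ω ⟩
      X * (D * C) + S * (2 * (N * (4 * T + S))) * ω  ≤⟨ +-monoʳ-≤ (X * (D * C)) (*-monoˡ-≤ ω (*-monoʳ-≤ S budget)) ⟩
      X * (D * C) + X * ω                            ∎))
      where
      open ≤-Reasoning
      ω = length Ω
      N = n * n
      S = s ^ 4
      T = (length B + 4 * s) ^ 3
      X = S * k ^ 3
      R = ∑[ q ∈ Ω ] representations q u
      C = ∑[ q ∈ Ω ] 𝟙 (covered? q u)
      E = ∑[ q ∈ Ω ] badRepresentations q u
      P = ∑[ q ∈ Ω ] coincidences q u
      X>0 : 0 < X
      X>0 = *-mono-≤ (m^n>0 s {{>-nonZero 0<s}} 4) (m^n>0 k {{>-nonZero (≤-trans (s≤s z≤n) 4≤k)}} 3)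
      R≤ : R ≤ C + E + P
      R≤ = ≤-trans (∑-mono Ω (λ {q} _ → representations-bound q u))
        (≤-reflexive (trans (∑-+ Ω _ _) (cong (_+ P) (∑-+ Ω _ _))))
      hits : X * ω ≤ N * N * R
      hits = subst (_≤ N * N * R) (trans (cong (_* (k ^ 3 * ω)) length-quads) (sym (*-assoc S (k ^ 3) ω)))
        (∑∑-≥ Ω (N * N) quads (λ {t} _ → total-hits k≤n 4≤k 4k≤u u≤n t))
      E≤ : N * E ≤ S * (4 * (T * ω))
      E≤ = subst₂ (λ S T → N * E ≤ S * (4 * (T * ω))) length-quads length-triples
        (∑∑-≤ Ω N quads λ t → ∑∑-≤ Ω N (allFin 4) λ g → ∑∑-≤ Ω N triples λ w → badQuad-rare u t g w)
      P≤ : N * P ≤ S * (S * ω)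
      P≤ = subst (λ S → N * P ≤ S * (S * ω)) length-quads
        (∑∑-≤ Ω N quads λ t → ∑∑-≤ Ω N quads λ t′ → twoQuads-rare u t t′)
      double : ∀ a → a + a ≡ 2 * a
      double = solve-∀
      expand : ∀ N C E P → 2 * (N * N * (C + E + P)) ≡ 2 * (N * N) * C + 2 * (N * (N * E + N * P))
      expand = solve-∀
      collect : ∀ D X C N S T ω → D * X * C + 2 * (N * (S * (4 * (T * ω)) + S * (S * ω))) ≡
                                  X * (D * C) + S * (2 * (N * (4 * T + S))) * ω
      collect = solve-∀

  -- The surviving draws keep the sums unique

  survivors : Sample → List ℕ
  survivors q = map (λ i → suc (lookup q i)) (filter (good? q) (allFin (4 * s)))

  extend : Sample → List ℕ
  extend q = B ++ survivors q

  length-extend : ∀ q → length (extend q) ≤ length B + 4 * s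
  length-extend q = begin
    length (extend q)                 ≡⟨ length-++ B ⟩
    length B + length (survivors q)   ≡⟨ cong (length B +_) (length-map _ (filter (good? q) (allFin (4 * s)))) ⟩
    length B + length (filter (good? q) (allFin (4 * s))) ≤⟨ +-monoʳ-≤ (length B) (length-filter _ (allFin (4 * s))) ⟩
    length B + length (allFin (4 * s))  ≡⟨ cong (length B +_) (length-allFin (4 * s)) ⟩
    length B + 4 * s                  ∎
    where open ≤-Reasoning

  -- Elements of the extended set are lifted to symbols, since badness is a statement about symbols
  -- and not about values.
  Admissible : Sample → Symbol → Set
  Admissible q (inj₁ i) = ¬ Bad q i
  Admissible q (inj₂ b) = b ∈ B

  extend⁻ : ∀ q {a} → a ∈ extend q → ∃ λ σ → Admissible q σ × a ≡ value q σ
  extend⁻ q {a} a∈ with ∈-++⁻ B a∈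
  ... | inj₁ a∈B = inj₂ a , a∈B , refl
  ... | inj₂ a∈S with i , i∈ , refl ← ∈-map⁻ _ a∈S =
    inj₁ i , proj₂ (∈-filter⁻ (good? q) {xs = allFin (4 * s)} i∈) , refl

  extend⁺ : ∀ q i → ¬ Bad q i → value q (inj₁ i) ∈ extend q
  extend⁺ q i good = ∈-++⁺ʳ B (∈-map⁺ _ (∈-filter⁺ (good? q) (∈-allFin i) good))

  extend-positive : (∀ {b} → b ∈ B → 0 < b) → ∀ q {a} → a ∈ extend q → 0 < a
  extend-positive B>0 q a∈ with extend⁻ q a∈
  ... | inj₁ i , _ , refl = s≤s z≤n
  ... | inj₂ b , b∈B , refl = B>0 b∈B

  admissible-symbol : ∀ q σ → Admissible q σ → σ ∈ symbols
  admissible-symbol q (inj₁ i) _   = ∈-++⁺ˡ (∈-map⁺ inj₁ (∈-allFin i))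
  admissible-symbol q (inj₂ b) b∈B = ∈-++⁺ʳ (map inj₁ (allFin (4 * s))) (∈-map⁺ inj₂ b∈B)

  -- If neither `β` nor `γ` is the symbol of `i`, the equation is a violation and `i` would be bad.
  -- Otherwise draw `i` stands on both sides and cancels.
  good-unique : ∀ q i α β γ → ¬ Bad q i → α ∈ symbols → β ∈ symbols → γ ∈ symbols →
    value q (inj₁ i) + value q α ≡ value q β + value q γ →
    (value q (inj₁ i) ≡ value q β × value q α ≡ value q γ) ⊎
    (value q (inj₁ i) ≡ value q γ × value q α ≡ value q β)
  good-unique q i α β γ good α∈ β∈ γ∈ eq with β ≟ₛ inj₁ i | γ ≟ₛ inj₁ i
  ... | yes refl | _        = inj₁ (refl , +-cancelˡ-≡ (value q (inj₁ i)) _ _ eq)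
  ... | no  _    | yes refl = inj₂ (refl , +-cancelˡ-≡ (value q (inj₁ i)) _ _ (trans eq (+-comm (value q β) _)))
  ... | no  β≢   | no  γ≢   = contradiction
    (lose (∈-allVecs (α ∷ β ∷ γ ∷ []) λ { 0F → α∈ ; 1F → β∈ ; 2F → γ∈ }) (β≢ , γ≢ , eq)) good

  -- As soon as one of the four symbols is a draw, the symmetries of the equation move it to the
  -- front and `good-unique` applies. The remaining case lies entirely in `B`.
  extend-unique : SumsAreUnique (_∈ B) → ∀ q → SumsAreUnique (_∈ extend q)
  extend-unique B-unique q a∈ b∈ c∈ d∈ eq
    with α , α-ok , refl ← extend⁻ q a∈ | β , β-ok , refl ← extend⁻ q b∈
       | γ , γ-ok , refl ← extend⁻ q c∈ | δ , δ-ok , refl ← extend⁻ q d∈ = go α β γ δ α-ok β-ok γ-ok δ-ok eq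
    where
    v = value q
    sy : ∀ {σ} → Admissible q σ → σ ∈ symbols
    sy {σ} = admissible-symbol q σ
    go : ∀ α β γ δ → Admissible q α → Admissible q β → Admissible q γ → Admissible q δ →
         v α + v β ≡ v γ + v δ → (v α ≡ v γ × v β ≡ v δ) ⊎ (v α ≡ v δ × v β ≡ v γ)
    go (inj₁ i) β γ δ α-ok β-ok γ-ok δ-ok eq =
      good-unique q i β γ δ α-ok (sy {β} β-ok) (sy {γ} γ-ok) (sy {δ} δ-ok) eq
    go α@(inj₂ _) (inj₁ i) γ δ α-ok β-ok γ-ok δ-ok eq =
      Sum.map (λ (p , r) → r , p) (λ (p , r) → r , p)
        (Sum.swap (good-unique q i α γ δ β-ok (sy {α} α-ok) (sy {γ} γ-ok) (sy {δ} δ-ok)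
          (trans (+-comm (v (inj₁ i)) (v α)) eq)))
    go α@(inj₂ _) β@(inj₂ _) (inj₁ i) δ α-ok β-ok γ-ok δ-ok eq =
      Sum.map (λ (p , r) → sym p , sym r) (λ (p , r) → sym r , sym p)
        (good-unique q i δ α β γ-ok (sy {δ} δ-ok) (sy {α} α-ok) (sy {β} β-ok) (sym eq))
    go α@(inj₂ _) β@(inj₂ _) γ@(inj₂ _) (inj₁ i) α-ok β-ok γ-ok δ-ok eq =
      Sum.map (λ (p , r) → sym r , sym p) (λ (p , r) → sym p , sym r)
        (Sum.swap (good-unique q i γ α β δ-ok (sy {γ} γ-ok) (sy {α} α-ok) (sy {β} β-ok)
          (trans (+-comm (v (inj₁ i)) (v γ)) (sym eq))))
    go (inj₂ a) (inj₂ b) (inj₂ c) (inj₂ d) α-ok β-ok γ-ok δ-ok eq = B-unique α-ok β-ok γ-ok δ-ok eq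

  extend-covers : ∀ q {u} → Covered q u → FourSum (_∈ extend q) u
  extend-covers q covered with t , _ , sums , good ← find covered =
    a 0F , a 1F , a 2F , a 3F , mem 0F , mem 1F , mem 2F , mem 3F ,
    trans (sym sums) (reassociate (a 0F) (a 1F) (a 2F) (a 3F))
    where
    a : Fin 4 → ℕ
    a g = value q (inj₁ (index t g))
    mem : ∀ g → a g ∈ extend q
    mem g = extend⁺ q (index t g) (good g)
    reassociate : ∀ a b c d → a + (b + (c + (d + 0))) ≡ a + b + c + d
    reassociate = solve-∀

-- Rounds at one scale

Valid : List ℕ → Set
Valid B = (∀ {b} → b ∈ B → 0 < b) × SumsAreUnique (_∈ B)

record Progress (B U : List ℕ) (size : ℕ) : Set where
  field
    extension : List ℕ
    remaining : List ℕ
    valid     : Valid extension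
    grows     : ∀ {b} → b ∈ B → b ∈ extension
    bounded   : length extension ≤ size
    covers    : ∀ {u} → u ∈ U → FourSum (_∈ extension) u ⊎ u ∈ remaining
    shrinks   : ∀ {u} → u ∈ remaining → u ∈ U

open Progress

FourSum-map : ∀ {P Q : ℕ → Set} → (∀ {a} → P a → Q a) → ∀ {u} → FourSum P u → FourSum Q u
FourSum-map P⇒Q (a₁ , a₂ , a₃ , a₄ , p₁ , p₂ , p₃ , p₄ , eq) =
  a₁ , a₂ , a₃ , a₄ , P⇒Q p₁ , P⇒Q p₂ , P⇒Q p₃ , P⇒Q p₄ , eq

-- Bernoulli's inequality 1 + m/E ≤ (1 + 1/E)^m, multiplied by E · E^m. The term `m * E ^ m` added
-- in the induction step is the usual discarded second-order term.
bernoulli : ∀ E m → (m + E) * E ^ m ≤ E * suc E ^ m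
bernoulli E zero    = ≤-refl
bernoulli E (suc m) = begin
  (suc m + E) * (E * E ^ m)     ≤⟨ m≤m+n _ (m * E ^ m) ⟩
  (suc m + E) * (E * E ^ m) + m * E ^ m ≡⟨ regroup E m (E ^ m) ⟩
  suc E * ((m + E) * E ^ m)     ≤⟨ *-monoʳ-≤ (suc E) (bernoulli E m) ⟩
  suc E * (E * suc E ^ m)       ≡⟨ exchange (suc E) E (suc E ^ m) ⟩
  E * (suc E * suc E ^ m)       ∎
  where
  open ≤-Reasoning
  regroup : ∀ E m p → (suc m + E) * (E * p) + m * p ≡ suc E * ((m + E) * p)
  regroup = solve-∀
  exchange : ∀ a b p → a * (b * p) ≡ b * (a * p)
  exchange = solve-∀

2*E^E≤[1+E]^E : ∀ E → 0 < E → 2 * E ^ E ≤ suc E ^ E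
2*E^E≤[1+E]^E E 0<E = *-cancelˡ-≤ E {{>-nonZero 0<E}} (≤-trans (≤-reflexive (regroup E (E ^ E))) (bernoulli E E))
  where
  regroup : ∀ E p → E * (2 * p) ≡ (E + E) * p
  regroup = solve-∀

-- Bernoulli with m = E shows that `E` reductions by the factor E/(E + 1) at least halve a quantity;
-- this is repeated `j` times.
halvings : ∀ E → 0 < E → ∀ j → E ^ (E * j) * 2 ^ j ≤ suc E ^ (E * j)
halvings E 0<E j = begin
  E ^ (E * j) * 2 ^ j      ≡⟨ cong (_* 2 ^ j) (^-*-assoc E E j) ⟨
  (E ^ E) ^ j * 2 ^ j      ≡⟨ *-comm ((E ^ E) ^ j) (2 ^ j) ⟩
  2 ^ j * (E ^ E) ^ j      ≡⟨ ^-distribʳ-* j ⟨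
  (2 * E ^ E) ^ j          ≤⟨ ^-monoˡ-≤ j (2*E^E≤[1+E]^E E 0<E) ⟩
  (suc E ^ E) ^ j          ≡⟨ ^-*-assoc (suc E) E j ⟩
  suc E ^ (E * j)          ∎
  where
  open ≤-Reasoning
  interchange : ∀ a b c d → a * b * (c * d) ≡ a * c * (b * d)
  interchange = solve-∀
  ^-distribʳ-* : ∀ j → (2 * E ^ E) ^ j ≡ 2 ^ j * (E ^ E) ^ j
  ^-distribʳ-* zero    = refl
  ^-distribʳ-* (suc j) = trans (cong (2 * E ^ E *_) (^-distribʳ-* j)) (interchange 2 (E ^ E) (2 ^ j) ((E ^ E) ^ j))

-- The covering probability is at least 1/(E + 1), so a round can leave at most the fraction E/(E +
-- 1) of the points. `T` caps the size of the set through all rounds, so that one `budget` serves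
-- them all.
module Rounds {n s k E T : ℕ} (0<s : 0 < s) (4≤k : 4 ≤ k) (k≤n : k ≤ n) (0<E : 0 < E)
              (budget : 2 * (n * n * (4 * T ^ 3 + s ^ 4)) ≤ k ^ 3)
              (density : 2 * (n * n * (n * n)) ≤ suc E * (s ^ 4 * k ^ 3)) where

  InWindow : List ℕ → Set
  InWindow U = ∀ {u} → u ∈ U → 4 * k ≤ u × u ≤ n

  -- Every point of `U` is covered by at least |Ω|/(E + 1) samples, so some sample covers at least
  -- |U|/(E + 1) points.
  round : ∀ B U → Valid B → InWindow U → length B + 4 * s ≤ T →
          ∃ λ (p : Progress B U (length B + 4 * s)) → suc E * length (remaining p) ≤ E * length U
  round B U (B>0 , B-unique) window fits =
    let q , large = ∑<∑⇒∃< Ω average in progress q , fewer q large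
    where
    open RandomExtension n s B
    gain : Sample → ℕ
    gain q = ∑[ u ∈ U ] 𝟙 (covered? q u)
    budget′ : 2 * (n * n * (4 * (length B + 4 * s) ^ 3 + s ^ 4)) ≤ k ^ 3
    budget′ = ≤-trans
      (*-monoʳ-≤ 2 (*-monoʳ-≤ (n * n) (+-monoˡ-≤ (s ^ 4) (*-monoʳ-≤ 4 (^-monoˡ-≤ 3 fits))))) budget
    Ω>0 : 0 < length Ω
    Ω>0 = subst (0 <_) (sym (trans (length-allVecs (upTo n) (4 * s)) (cong (_^ (4 * s)) (length-upTo n))))
            (m^n>0 n {{>-nonZero (≤-trans (≤-trans (s≤s z≤n) 4≤k) k≤n)}} (4 * s))
    covered-often : ∀ {u} → u ∈ U → length Ω ≤ suc E * ∑[ q ∈ Ω ] 𝟙 (covered? q u)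
    covered-often u∈ =
      coverage {D = suc E} k≤n 4≤k (proj₁ (window u∈)) (proj₂ (window u∈)) 0<s budget′ density
    -- The added 1, together with `Ω` being non-empty, makes the comparison strict; for integers
    -- `length U < 1 + m` is again `length U ≤ m`.
    average : ∑[ _ ∈ Ω ] length U < ∑[ q ∈ Ω ] (1 + suc E * gain q)
    average = begin-strict
      ∑[ _ ∈ Ω ] length U                      ≡⟨ trans (∑-const Ω (length U)) (*-comm (length Ω) (length U)) ⟩
      length U * length Ω                      ≤⟨ ∑∑-≥ Ω (suc E) U covered-often ⟩
      suc E * ∑ Ω gain                         ≡⟨ *-∑ (suc E) Ω gain ⟩
      ∑[ q ∈ Ω ] (suc E * gain q)              <⟨ m<n+m _ Ω>0 ⟩
      length Ω + ∑[ q ∈ Ω ] (suc E * gain q)   ≡⟨ cong (_+ ∑[ q ∈ Ω ] (suc E * gain q))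
                                                      (trans (∑-const Ω 1) (*-identityʳ (length Ω))) ⟨
      ∑[ _ ∈ Ω ] 1 + ∑[ q ∈ Ω ] (suc E * gain q) ≡⟨ ∑-+ Ω (λ _ → 1) (λ q → suc E * gain q) ⟨
      ∑[ q ∈ Ω ] (1 + suc E * gain q)          ∎
      where open ≤-Reasoning
    uncovered? : ∀ q → Decidable (λ u → ¬ Covered q u)
    uncovered? q u = ¬? (covered? q u)
    progress : ∀ q → Progress B U (length B + 4 * s)
    progress q .extension = extend q
    progress q .remaining = filter (uncovered? q) U
    progress q .valid = extend-positive B>0 q , extend-unique B-unique q
    progress q .grows = ∈-++⁺ˡ
    progress q .bounded = length-extend q
    progress q .covers {u} u∈ with covered? q u
    ... | yes covered = inj₁ (extend-covers q covered)
    ... | no  ¬covered = inj₂ (∈-filter⁺ (uncovered? q) u∈ ¬covered)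
    progress q .shrinks u∈ = proj₁ (∈-filter⁻ (uncovered? q) u∈)
    fewer : ∀ q → length U < 1 + suc E * gain q →
            suc E * length (filter (uncovered? q) U) ≤ E * length U
    -- Covered and remaining points together make up `U`, so a lower bound on the gain is an upper
    -- bound on what remains.
    fewer q large = +-cancelˡ-≤ (suc E * gain q) _ _ (begin
      suc E * gain q + suc E * length (filter (uncovered? q) U)  ≡⟨ *-distribˡ-+ (suc E) (gain q) _ ⟨
      suc E * (gain q + length (filter (uncovered? q) U))        ≡⟨ cong (suc E *_) (∑𝟙+length-filter (covered? q) U) ⟩
      length U + E * length U                                    ≤⟨ +-monoˡ-≤ (E * length U) (≤-pred large) ⟩
      suc E * gain q + E * length U                              ∎)
      where open ≤-Reasoning

  Shrunk : ℕ → ℕ → List ℕ → List ℕ → Set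
  Shrunk r size B U = ∃ λ (p : Progress B U size) → suc E ^ r * length (remaining p) ≤ E ^ r * length U

  rounds : ∀ r B U → Valid B → InWindow U → length B + r * (4 * s) ≤ T → Shrunk r (length B + r * (4 * s)) B U
  rounds zero B U B-valid window fits = record
    { extension = B ; remaining = U ; valid = B-valid ; grows = id
    ; bounded = m≤m+n _ 0 ; covers = inj₂ ; shrinks = id } , ≤-refl
  rounds (suc r) B U B-valid window fits = continue
    (round B U B-valid window (≤-trans (+-monoʳ-≤ (length B) (m≤m+n (4 * s) (r * (4 * s)))) fits))
    where
    continue : (∃ λ (p : Progress B U (length B + 4 * s)) → suc E * length (remaining p) ≤ E * length U) →
               Shrunk (suc r) (length B + suc r * (4 * s)) B U
    continue (p , p-fewer) =
      finish (rounds r (extension p) (remaining p) (valid p) (window ∘ shrinks p) (≤-trans bound fits))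
      where
      bound : length (extension p) + r * (4 * s) ≤ length B + suc r * (4 * s)
      bound = ≤-trans (+-monoˡ-≤ (r * (4 * s)) (bounded p)) (≤-reflexive (+-assoc (length B) (4 * s) (r * (4 * s))))
      finish : Shrunk r (length (extension p) + r * (4 * s)) (extension p) (remaining p) →
               Shrunk (suc r) (length B + suc r * (4 * s)) B U
      finish (p′ , p′-fewer) = record
        { extension = extension p′
        ; remaining = remaining p′
        ; valid = valid p′
        ; grows = grows p′ ∘ grows p
        ; bounded = ≤-trans (bounded p′) bound
        ; covers = λ u∈ → Sum.[ inj₁ ∘ FourSum-map (grows p′) , covers p′ ] (covers p u∈)
        ; shrinks = shrinks p ∘ shrinks p′
        } , (begin
          suc E * suc E ^ r * length (remaining p′)    ≡⟨ *-assoc (suc E) (suc E ^ r) _ ⟩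
          suc E * (suc E ^ r * length (remaining p′))  ≤⟨ *-monoʳ-≤ (suc E) p′-fewer ⟩
          suc E * (E ^ r * length (remaining p))       ≡⟨ exchange (suc E) (E ^ r) _ ⟩
          E ^ r * (suc E * length (remaining p))       ≤⟨ *-monoʳ-≤ (E ^ r) p-fewer ⟩
          E ^ r * (E * length U)                       ≡⟨ exchange′ (E ^ r) E (length U) ⟩
          E * E ^ r * length U                         ∎)
        where
        open ≤-Reasoning
        exchange : ∀ a b c → a * (b * c) ≡ b * (a * c)
        exchange = solve-∀
        exchange′ : ∀ a b c → a * (b * c) ≡ b * a * c
        exchange′ = solve-∀

  CoveredBy : ℕ → List ℕ → List ℕ → Set
  CoveredBy size B U = ∃ λ B′ → Valid B′ × (∀ {b} → b ∈ B → b ∈ B′) × length B′ ≤ size ×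
                       (∀ {u} → u ∈ U → FourSum (_∈ B′) u)

  -- After `E * j` rounds fewer than |U|/2^j < 1 points could remain, up to equality in the first
  -- bound, hence none.
  cover-window : ∀ j B U → Valid B → InWindow U → length U < 2 ^ j → length B + E * j * (4 * s) ≤ T →
                 CoveredBy (length B + E * j * (4 * s)) B U
  cover-window j B U B-valid window U-small fits = finish (rounds (E * j) B U B-valid window fits)
    where
    nothing-left : ∀ R → suc E ^ (E * j) * length R ≤ E ^ (E * j) * length U → ∀ {u} → ¬ (u ∈ R)
    -- A single remaining point would already give (E + 1)^(Ej) < (E + 1)^(Ej).
    nothing-left (x ∷ R) fewer _ = <-irrefl refl (begin-strict
      suc E ^ (E * j)                     ≤⟨ m≤m*n (suc E ^ (E * j)) (suc (length R)) ⟩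
      suc E ^ (E * j) * suc (length R)    ≤⟨ fewer ⟩
      E ^ (E * j) * length U              <⟨ *-monoʳ-< (E ^ (E * j)) {{m^n≢0 E (E * j) {{>-nonZero 0<E}}}} U-small ⟩
      E ^ (E * j) * 2 ^ j                 ≤⟨ halvings E 0<E j ⟩
      suc E ^ (E * j)                     ∎)
      where open ≤-Reasoning
    finish : Shrunk (E * j) (length B + E * j * (4 * s)) B U → CoveredBy (length B + E * j * (4 * s)) B U
    finish (p , fewer) = extension p , valid p , grows p , bounded p ,
      λ u∈ → Sum.[ id , (λ u∈R → contradiction u∈R (nothing-left (remaining p) fewer)) ] (covers p u∈)

-- Passing through all scales

between : ∀ (f : ℕ → ℕ) {u} m → f 0 ≤ u → u < f m → ∃ λ i → f i ≤ u × u < f (suc i)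
between f     zero    f0≤u u<f0 = contradiction f0≤u (<⇒≱ u<f0)
between f {u} (suc m) f0≤u u<fm with u <? f m
... | yes u<fm′ = between f m f0≤u u<fm′
... | no  u≮fm′ = m , ≮⇒≥ u≮fm′ , u<fm

n<2^n : ∀ n → n < 2 ^ n
n<2^n zero    = s≤s z≤n
n<2^n (suc n) = begin-strict
  suc n            <⟨ s≤s (n<2^n n) ⟩
  1 + 2 ^ n        ≤⟨ +-monoˡ-≤ (2 ^ n) (m^n>0 2 n) ⟩
  2 ^ n + 2 ^ n    ≡⟨ cong (2 ^ n +_) (+-identityʳ (2 ^ n)) ⟨
  2 ^ suc n        ∎
  where open ≤-Reasoning

-- The half-open interval from 4k to 64k. Doubling s multiplies k by 16 and 4 · 16 = 64, so the
-- windows of consecutive scales abut.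
window : ℕ → List ℕ
window k = map (4 * k +_) (upTo (60 * k))

4k+60k≡64k : ∀ k → 4 * k + 60 * k ≡ 64 * k
4k+60k≡64k k = sym (*-distribʳ-+ k 4 60)

window-range : ∀ k {u} → u ∈ window k → 4 * k ≤ u × u ≤ 64 * k
window-range k u∈ with v , v∈ , refl ← ∈-map⁻ (4 * k +_) u∈ =
  m≤m+n (4 * k) v , subst (4 * k + v ≤_) (4k+60k≡64k k) (+-monoʳ-≤ (4 * k) (<⇒≤ (∈-upTo⁻ v∈)))

window-complete : ∀ k {u} → 4 * k ≤ u → u < 64 * k → u ∈ window k
window-complete k {u} 4k≤u u<64k = subst (_∈ window k) (m+[n∸m]≡n 4k≤u) (∈-map⁺ (4 * k +_) (∈-upTo⁺
  (+-cancelˡ-< (4 * k) (u ∸ 4 * k) (60 * k)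
    (subst₂ _<_ (sym (m+[n∸m]≡n 4k≤u)) (sym (4k+60k≡64k k)) u<64k))))

-- With k = 2¹⁴ s⁴ and draws from [1, 64k], the bound on the coverage probability
-- of a point is s⁴k³ / (2 (64k)⁴) = 2⁻³⁹; this is what E-large encodes.
module Construction (E ℓ₀ : ℕ) (E-large : 64 * 64 * (64 * 64) * 2 * 16384 ≤ suc E)
                    (growth : ∀ i → 32 * (4 * E * (4 * (i + ℓ₀) + 21)) ^ 3 ≤ 2 ^ (i + ℓ₀)) where

  abstract
    -- The factor 16384 = 64² · 2 · 2 makes k³ equal to 2 (64k)² (s⁴ + s⁴), which is what `budget`
    -- needs once 4T³ ≤ s⁴.
    scale : ℕ → ℕ
    scale ℓ = 16384 * (2 ^ ℓ) ^ 4

    scale-def : ∀ ℓ → scale ℓ ≡ 16384 * (2 ^ ℓ) ^ 4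
    scale-def ℓ = refl

  -- The window has 60k < 2⁷ · 2¹⁴ · 2^(4ℓ) points, so this many halvings empty it.
  halvingsAt : ℕ → ℕ
  halvingsAt ℓ = 4 * ℓ + 21

  -- The number of draws made at scale `ℓ`: `E * halvingsAt ℓ` rounds of `4 * 2 ^ ℓ` draws. It at
  -- least doubles from one scale to the next, so it can also bound the set that enters the scale.
  sizeBound : ℕ → ℕ
  sizeBound ℓ = 4 * E * halvingsAt ℓ * 2 ^ ℓ

  s⁴>0 : ∀ ℓ → 0 < (2 ^ ℓ) ^ 4
  s⁴>0 ℓ = m^n>0 (2 ^ ℓ) {{m^n≢0 2 ℓ}} 4

  module _ (ℓ : ℕ) (growth-ℓ : 32 * (4 * E * halvingsAt ℓ) ^ 3 ≤ 2 ^ ℓ) where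

    private
      s = 2 ^ ℓ
      k = scale ℓ
      n = 64 * k
      j = halvingsAt ℓ
      T = 2 * sizeBound ℓ

    0<E : 0 < E
    0<E = ≤-pred (≤-trans (s≤s (s≤s z≤n)) E-large)

    4≤k : 4 ≤ k
    4≤k = subst (4 ≤_) (sym (scale-def ℓ))
      (≤-trans (≤ᵇ⇒≤ 4 16384 _) (m≤m*n 16384 (s ^ 4) {{>-nonZero (s⁴>0 ℓ)}}))

    -- `T` is `s` times a factor linear in `ℓ`. Its cube is s³ times a cubic in `ℓ`, and `growth-ℓ`
    -- absorbs that cubic into one more factor `s`.
    T-small : 4 * T ^ 3 ≤ s ^ 4
    T-small = begin
      4 * T ^ 3                          ≡⟨ regroup (4 * E * j) s ⟩
      32 * (4 * E * j) ^ 3 * s ^ 3       ≤⟨ *-monoˡ-≤ (s ^ 3) growth-ℓ ⟩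
      s ^ 4                              ∎
      where
      open ≤-Reasoning
      regroup : ∀ a s → 4 * ((2 * (a * s)) * ((2 * (a * s)) * ((2 * (a * s)) * 1))) ≡
                        32 * (a * (a * (a * 1))) * (s * (s * (s * 1)))
      regroup = solve-∀

    budget : 2 * (n * n * (4 * T ^ 3 + s ^ 4)) ≤ k ^ 3
    budget = begin
      2 * (n * n * (4 * T ^ 3 + s ^ 4))     ≤⟨ *-monoʳ-≤ 2 (*-monoʳ-≤ (n * n) (+-monoˡ-≤ (s ^ 4) T-small)) ⟩
      2 * (n * n * (s ^ 4 + s ^ 4))         ≡⟨ regroup 64 k (s ^ 4) ⟩
      64 * 64 * 2 * 2 * s ^ 4 * (k * k)     ≡⟨ cong (_* (k * k)) (scale-def ℓ) ⟨
      k * (k * k)                           ≡⟨ cube k ⟩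
      k ^ 3                                 ∎
      where
      open ≤-Reasoning
      regroup : ∀ c k S → 2 * (c * k * (c * k) * (S + S)) ≡ c * c * 2 * 2 * S * (k * k)
      regroup = solve-∀
      cube : ∀ k → k * (k * k) ≡ k * (k * (k * 1))
      cube = solve-∀

    density : 2 * (n * n * (n * n)) ≤ suc E * (s ^ 4 * k ^ 3)
    density = begin
      -- Of the four factors k, exactly one is rewritten as 16384 s⁴, which produces s⁴k³.
      2 * (n * n * (n * n))                                  ≡⟨ regroup 64 16384 (s ^ 4) (k ^ 3) k (scale-def ℓ) (cube k) ⟩
      64 * 64 * (64 * 64) * 2 * 16384 * (s ^ 4 * k ^ 3)      ≤⟨ *-monoˡ-≤ (s ^ 4 * k ^ 3) E-large ⟩
      suc E * (s ^ 4 * k ^ 3)                                ∎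
      where
      open ≤-Reasoning
      cube : ∀ k → k * (k * k) ≡ k * (k * (k * 1))
      cube = solve-∀
      expand : ∀ c d S k → 2 * (c * k * (c * k) * (c * k * (c * k))) ≡ c * c * (c * c) * 2 * k * (k * (k * k))
      expand = solve-∀
      assoc : ∀ a d S K → a * (d * S) * K ≡ a * d * (S * K)
      assoc = solve-∀
      regroup : ∀ c d S K k → k ≡ d * S → k * (k * k) ≡ K →
                2 * (c * k * (c * k) * (c * k * (c * k))) ≡ c * c * (c * c) * 2 * d * (S * K)
      regroup c d S K k k≡ refl = trans (expand c d S k)
        (trans (cong (λ x → c * c * (c * c) * 2 * x * (k * (k * k))) k≡) (assoc (c * c * (c * c) * 2) d S _))

    window-small : length (window k) < 2 ^ j
    window-small = begin-strict
      length (window k)   ≡⟨ trans (length-map (4 * k +_) (upTo (60 * k))) (length-upTo (60 * k)) ⟩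
      60 * k              <⟨ *-monoˡ-< k {{>-nonZero (≤-trans (s≤s z≤n) 4≤k)}} {60} {128} (≤ᵇ⇒≤ 61 128 _) ⟩
      128 * k             ≡⟨ trans (cong (128 *_) (scale-def ℓ)) (sym (*-assoc 128 16384 (s ^ 4))) ⟩
      2 ^ 21 * s ^ 4      ≡⟨ *-comm (2 ^ 21) (s ^ 4) ⟩
      s ^ 4 * 2 ^ 21      ≡⟨ cong (_* 2 ^ 21) (trans (^-*-assoc 2 ℓ 4) (cong (2 ^_) (*-comm ℓ 4))) ⟩
      2 ^ (4 * ℓ) * 2 ^ 21 ≡⟨ ^-distribˡ-+-* 2 (4 * ℓ) 21 ⟨
      2 ^ j               ∎
      where open ≤-Reasoning

    CoversScale : List ℕ → Set
    CoversScale B = ∃ λ B′ → Valid B′ × length B′ ≤ sizeBound (suc ℓ) × (∀ {b} → b ∈ B → b ∈ B′) ×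
                             (∀ {u} → 4 * k ≤ u → u < n → FourSum (_∈ B′) u)

    cover-scale : ∀ B → Valid B → length B ≤ sizeBound ℓ → CoversScale B
    cover-scale B B-valid B-small = finish (cover-window j B (window k) B-valid (window-range k) window-small
        (≤-trans grown (≤-reflexive (cong (sizeBound ℓ +_) (sym (+-identityʳ (sizeBound ℓ)))))))
      where
      open Rounds {n} {s} {k} {E} {T} (m^n>0 2 ℓ) 4≤k (m≤m+n k (63 * k)) 0<E budget density
      regroup : ∀ E j s → E * j * (4 * s) ≡ 4 * E * j * s
      regroup = solve-∀
      grown : length B + E * j * (4 * s) ≤ sizeBound ℓ + sizeBound ℓ
      grown = +-mono-≤ B-small (≤-reflexive (regroup E j s))
      double : ∀ a j s → a * j * s + a * j * s ≡ a * j * (2 * s)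
      double = solve-∀
      next : sizeBound ℓ + sizeBound ℓ ≤ sizeBound (suc ℓ)
      next = ≤-trans (≤-reflexive (double (4 * E) j s))
        (*-monoˡ-≤ (2 * s) (*-monoʳ-≤ (4 * E) (+-monoˡ-≤ 21 (*-monoʳ-≤ 4 (n≤1+n ℓ)))))
      finish : CoveredBy (length B + E * j * (4 * s)) B (window k) → CoversScale B
      finish (B′ , valid , grows , bounded , covers) =
        B′ , valid , ≤-trans bounded (≤-trans grown next) , grows ,
          λ 4k≤u u<n → covers (window-complete k 4k≤u u<n)

  Stage : ℕ → Set
  Stage i = ∃ λ B → Valid B × length B ≤ sizeBound (i + ℓ₀)

  -- Takes the given stage as an argument, so that inclusion and covering speak of the very set that
  -- `stage (suc i)` selects.
  advance : ∀ i (st : Stage i) → ∃ λ (st′ : Stage (suc i)) →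
            (∀ {b} → b ∈ proj₁ st → b ∈ proj₁ st′) ×
            (∀ {u} → 4 * scale (i + ℓ₀) ≤ u → u < 64 * scale (i + ℓ₀) → FourSum (_∈ proj₁ st′) u)
  advance i (B , valid , small) =
    let B′ , valid′ , small′ , grows , covers = cover-scale (i + ℓ₀) (growth i) B valid small
    in (B′ , valid′ , small′) , grows , covers

  stage : ∀ i → Stage i
  stage zero    = [] , ((λ ()) , λ ()) , z≤n
  stage (suc i) = proj₁ (advance i (stage i))

  basis : ℕ → List ℕ
  basis i = proj₁ (stage i)

  basis-mono : ∀ {i i′ b} → i ≤′ i′ → b ∈ basis i → b ∈ basis i′
  basis-mono (≤′-reflexive refl)             b∈ = b∈
  basis-mono {i′ = suc i′} (≤′-step i≤′i′)   b∈ =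
    proj₁ (proj₂ (advance i′ (stage i′))) (basis-mono i≤′i′ b∈)

  A : SetOfℕ
  A a = ∃ λ i → a ∈ basis i

  A-positive : Positive A
  A-positive a (i , a∈) = proj₁ (proj₁ (proj₂ (stage i))) a∈

  -- An equation involves only four elements, and the stages are nested, so all four lie in one
  -- finite stage.
  A-unique : SumsAreUnique A
  A-unique (i , a∈) (i′ , b∈) (j , c∈) (j′ , d∈) =
    proj₂ (proj₁ (proj₂ (stage m)))
      (up (m≤m+n i _) a∈) (up (≤-trans (m≤m+n i′ _) (m≤n+m _ i)) b∈)
      (up (≤-trans (m≤m+n j j′) (≤-trans (m≤n+m _ i′) (m≤n+m _ i))) c∈)
      (up (≤-trans (m≤n+m j′ j) (≤-trans (m≤n+m _ i′) (m≤n+m _ i))) d∈)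
    where
    m = i + (i′ + (j + j′))
    up : ∀ {i b} → i ≤ m → b ∈ basis i → b ∈ basis m
    up i≤m = basis-mono (≤⇒≤′ i≤m)

  A-sidon : Sidon A
  A-sidon a b c d a∈ b∈ c∈ d∈ a≤b c≤d eq with A-unique a∈ b∈ c∈ d∈ eq
  ... | inj₁ same         = same
  -- With the pairs swapped, the two order hypotheses force all four elements to be equal.
  ... | inj₂ (refl , refl) = ≤-antisym a≤b c≤d , ≤-antisym c≤d a≤b

  threshold : ℕ → ℕ
  threshold i = 4 * scale (i + ℓ₀)

  threshold-suc : ∀ i → threshold (suc i) ≡ 64 * scale (i + ℓ₀)
  threshold-suc i = begin
    4 * scale (suc i + ℓ₀)                      ≡⟨ cong (4 *_) (scale-def (suc i + ℓ₀)) ⟩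
    4 * (16384 * (2 ^ (suc i + ℓ₀)) ^ 4)        ≡⟨ regroup 16384 (2 ^ (i + ℓ₀)) (2 ^ (suc i + ℓ₀)) refl ⟩
    64 * (16384 * (2 ^ (i + ℓ₀)) ^ 4)           ≡⟨ cong (64 *_) (scale-def (i + ℓ₀)) ⟨
    64 * scale (i + ℓ₀)                         ∎
    where
    open ≡-Reasoning
    expand : ∀ d s → 4 * (d * ((2 * s) * ((2 * s) * ((2 * s) * ((2 * s) * 1))))) ≡
                     64 * (d * (s * (s * (s * (s * 1)))))
    expand = solve-∀
    regroup : ∀ d s s′ → s′ ≡ 2 * s → 4 * (d * s′ ^ 4) ≡ 64 * (d * s ^ 4)
    regroup d s _ refl = expand d s

  threshold-unbounded : ∀ u → u < threshold u
  threshold-unbounded u = begin-strict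
    u                               <⟨ n<2^n u ⟩
    2 ^ u                           ≤⟨ ^-monoʳ-≤ 2 (m≤m+n u ℓ₀) ⟩
    s                               ≤⟨ m≤m*n s (s ^ 3) {{m^n≢0 s 3 {{m^n≢0 2 (u + ℓ₀)}}}} ⟩
    s ^ 4                           ≤⟨ m≤n*m (s ^ 4) 16384 ⟩
    16384 * s ^ 4                   ≡⟨ scale-def (u + ℓ₀) ⟨
    scale (u + ℓ₀)                  ≤⟨ m≤n*m (scale (u + ℓ₀)) 4 ⟩
    threshold u                     ∎
    where
    open ≤-Reasoning
    s = 2 ^ (u + ℓ₀)

  -- The thresholds are unbounded and cut the integers from `threshold 0` on into the windows. A
  -- point of window `i` is a sum of four elements of the stage after it, `suc i`.
  A-basis : AsymptoticBasis4 A
  A-basis = threshold 0 , λ u 0<u →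
    let i , lower , upper = between threshold u (<⇒≤ 0<u) (threshold-unbounded u)
    in FourSum-map (suc i ,_) (proj₂ (proj₂ (advance i (stage i))) lower (subst (u <_) (threshold-suc i) upper))

-- Choice of the constants

cubic≤exponential : ∀ c {m p} → 16 ≤ m → 32 * (c * m) ^ 3 ≤ p → 32 * (c * (4 + m)) ^ 3 ≤ 2 * p
cubic≤exponential c {m} {p} 16≤m bound = begin
  32 * (c * (4 + m)) ^ 3       ≡⟨ expand c m ⟩
  -- From m ≥ 16 follow 48m ≤ 3m² and 64 ≤ m², so the lower-order terms of (m + 4)³ add up to at
  -- most 16m² ≤ m³.
  32 * c ^ 3 * (m * m * m + 12 * m * m + 48 * m + 16 * 4)
    ≤⟨ *-monoʳ-≤ (32 * c ^ 3) (+-mono-≤ (+-monoʳ-≤ (m * m * m + 12 * m * m) (*-monoˡ-≤ m 48≤3m)) 16*4≤m*m) ⟩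
  32 * c ^ 3 * (m * m * m + 12 * m * m + 3 * m * m + m * m)
    ≡⟨ collect c m ⟩
  32 * c ^ 3 * (m * m * m + 16 * (m * m))
    ≤⟨ *-monoʳ-≤ (32 * c ^ 3) (+-monoʳ-≤ (m * m * m) (*-monoˡ-≤ (m * m) 16≤m)) ⟩
  32 * c ^ 3 * (m * m * m + m * (m * m)) ≡⟨ double c m ⟩
  2 * (32 * (c * m) ^ 3)       ≤⟨ *-monoʳ-≤ 2 bound ⟩
  2 * p                        ∎
  where
  open ≤-Reasoning
  48≤3m : 48 ≤ 3 * m
  48≤3m = *-monoʳ-≤ 3 16≤m
  16*4≤m*m : 16 * 4 ≤ m * m
  16*4≤m*m = *-mono-≤ 16≤m (≤-trans (≤ᵇ⇒≤ 4 16 _) 16≤m)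
  expand : ∀ c m → 32 * ((c * (4 + m)) * ((c * (4 + m)) * ((c * (4 + m)) * 1))) ≡
                     32 * (c * (c * (c * 1))) * (m * m * m + 12 * m * m + 48 * m + 64)
  expand = solve-∀
  collect : ∀ c m → 32 * (c * (c * (c * 1))) * (m * m * m + 12 * m * m + 3 * m * m + m * m) ≡
                     32 * (c * (c * (c * 1))) * (m * m * m + 16 * (m * m))
  collect = solve-∀
  double : ∀ c m → 32 * (c * (c * (c * 1))) * (m * m * m + m * (m * m)) ≡
                     2 * (32 * ((c * m) * ((c * m) * ((c * m) * 1))))
  double = solve-∀

-- Raising ℓ by 1 raises m = 4ℓ + 21 by 4, which at most doubles the cubic, while the right side
-- doubles exactly. At ℓ = 200 one has m = 821 < 2¹⁰, so the left side is below 2^(5 + 3 · 51) =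
-- 2¹⁵⁸.
growth : ∀ i → 32 * (4 * 2 ^ 39 * (4 * (i + 200) + 21)) ^ 3 ≤ 2 ^ (i + 200)
growth zero    = ≤ᵇ⇒≤ _ _ _
growth (suc i) = subst (λ m → 32 * (4 * 2 ^ 39 * m) ^ 3 ≤ 2 ^ (suc i + 200)) (shift (i + 200))
  (cubic≤exponential (4 * 2 ^ 39) (≤-trans (≤ᵇ⇒≤ 16 21 _) (m≤n+m 21 (4 * (i + 200)))) (growth i))
  where
  shift : ∀ x → 4 + (4 * x + 21) ≡ 4 * suc x + 21
  shift = solve-∀

theorem1 : Σ SetOfℕ (λ A → Positive A × Sidon A × AsymptoticBasis4 A)
theorem1 = A , A-positive , A-sidon , A-basis
  -- 64⁴ · 2 · 16384 = 2³⁹, so the condition on `E` reads 2³⁹ ≤ 2³⁹ + 1.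
  where open Construction (2 ^ 39) 200 (n≤1+n _) growth
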